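{- For every positive integer $n$, $$\Phi^{(3)}[a, a'; b, b'; cq^{ -n}; x, y] = \frac{1}{(q/c; q)_n} \sum_{k=0}^n \begin{bmatrix} n \\ k \end{bmatrix} (-c)^{k-n} q^{\binom{n+1-k}{2}} \Phi^{(3)}[a, a'; b, b'; c; xq^k, yq^k],$$ and $$\Phi^{(3)}[a, a'; b, b'; cq^n; x, y] = \sum_{k=0}^n \begin{bmatrix} n \\ k \end{bmatrix} c^k q^{2\binom{k}{2}} (cq^k; q)_{n-k}\, \Phi^{(3)}[a, a'; b, b'; cq^k; xq^k, yq^k].$$
   Context: Let $q$ be a complex number with $|q|<1$. For a complex number $z$ and an integer $N\ge 0$, $(z;q)_N=\prod_{j=0}^{N-1}(1-zq^j)$. The $q$-binomial coefficient is $\begin{bmatrix} n \\ k \end{bmatrix}=\frac{(q;q)_n}{(q;q)_k(q;q)_{n-k}}$ for $0\le k\le n$, and $\binom{k}{2}=k(k-1)/2$. The $q$-Appell function $\Phi^{(3)}$ is $$\Phi^{(3)}[a, a'; b, b'; c; x, y] = \sum_{m, n \geq 0} \frac{(a; q)_m (a'; q)_n (b; q)_m (b'; q)_n}{(q; q)_m (q; q)_n (c; q)_{m+n}} x^m y^n .$$ All identities are understood as identities of power series in $x,y$ (convergent for $|x|,|y|$ sufficiently small), with parameters generic so that no denominator appearing vanishes. -}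

module Defs where

open import Level using (Level; _⊔_)
open import Data.Nat using (ℕ; zero; suc; _∸_)
open import Relation.Nullary using (¬_)
open import Algebra.Bundles using (CommutativeRing)

-- A field: a commutative ring with a (total) inverse operation that is a
-- genuine inverse on every nonzero element.  (The value of 0⁻¹ is irrelevant.)
record Field (c ℓ : Level) : Set (Level.suc (c ⊔ ℓ)) where
  field
    commutativeRing : CommutativeRing c ℓ
  open CommutativeRing commutativeRing public
  field
    _⁻¹       : Carrier → Carrier
    ⁻¹-inverse : ∀ x → ¬ (x ≈ 0#) → (x * (x ⁻¹)) ≈ 1#

module QDefs {c ℓ : Level} (F : Field c ℓ) where
  open Field F

  pow : Carrier → ℕ → Carrier
  pow x zero    = 1#
  pow x (suc k) = x * pow x k

  poch : Carrier → Carrier → ℕ → Carrier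
  poch z q zero    = 1#
  poch z q (suc N) = poch z q N * (1# - (z * pow q N))

  -- q-binomial coefficient [n k] = (q;q)_n / ((q;q)_k (q;q)_{n-k})   (used for k ≤ n)
  qbin : Carrier → ℕ → ℕ → Carrier
  qbin q n k = poch q q n * ((poch q q k * poch q q (n ∸ k)) ⁻¹)

  sumTo : ℕ → (ℕ → Carrier) → Carrier
  sumTo zero    f = f 0
  sumTo (suc n) f = sumTo n f + f (suc n)

  -- formal power series in two variables x, y: coefficient of x^m y^l
  Series : Set c
  Series = ℕ → ℕ → Carrier

  _≋_ : Series → Series → Set ℓ
  S ≋ T = ∀ m l → S m l ≈ T m l

  _·ₛ_ : Carrier → Series → Series
  (s ·ₛ S) m l = s * S m l

  sumSeries : ℕ → (ℕ → Series) → Series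
  sumSeries n S m l = sumTo n (λ k → S k m l)

  -- Φ3 q a a' b b' c u v  is the q-Appell series
  --   Φ^{(3)}[a, a'; b, b'; c; u x, v y]
  -- as a formal power series in x, y (with base q): its coefficient of x^m y^l is
  --   (a;q)_m (a';q)_l (b;q)_m (b';q)_l / ((q;q)_m (q;q)_l (c;q)_{m+l}) · u^m v^l.
  Φ3 : (q a a' b b' γ u v : Carrier) → Series
  Φ3 q a a' b b' γ u v m l =
    ((poch a q m * poch a' q l * poch b q m * poch b' q l)
      * ((poch q q m * poch q q l * poch γ q (m Data.Nat.+ l)) ⁻¹))
      * (pow u m * pow v l)

-- Proof (the parameter c is called γ below).  On the diagonal (ux, uy) the
-- coefficient of x^m y^l of Φ^{(3)} is a factor independent of c and u
-- times (c;q)_N⁻¹ u^N with N = m + l (Φ3-coefficient).  Hence both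
-- identities reduce, for every N, to an identity between reciprocals of
-- q-Pochhammer symbols:
--   * the first (FirstIdentity) follows from the q-binomial theorem applied
--     to (dq^N;q)_n, d = cq^{-n}, together with the reversal
--     (d;q)_n = (q/c;q)_n (-d)^n q^{binom(n,2)};
--   * the second (SecondIdentity) is the inverse relation
--     Σ_k [n k] z^k q^{2 binom(k,2)} (zq^k;q)_{n-k} = 1 at z = cq^N.

module Submission where

open import Level using (Level)
open import Data.Nat using (ℕ; zero; suc; _≤_; _<_; _∸_; z≤n; s≤s)
import Data.Nat as ℕ
import Data.Nat.Properties as ℕP
open import Data.Nat.Combinatorics using (_C_; nC1≡n; nCk+nC[k+1]≡[n+1]C[k+1])
open import Data.Nat.Tactic.RingSolver using (solve-∀)
open import Data.Integer as ℤ using (ℤ; +_; -[1+_]; _⊖_)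
import Data.Integer.Properties as ℤP
open import Data.Sign as Sign using (Sign)
open import Data.Maybe using (Maybe; just; nothing)
open import Data.Product using (_×_; _,_)
open import Data.Sum using (inj₁; inj₂)
open import Relation.Nullary using (¬_; yes; no)
open import Relation.Binary.PropositionalEquality as P using (_≡_)
open import Algebra.Bundles using (CommutativeRing)
open import Algebra.Solver.Ring.AlmostCommutativeRing
  using (fromCommutativeRing; _-Raw-AlmostCommutative⟶_)
open import Defs

C2-suc : ∀ n → suc n C 2 ≡ n ℕ.+ n C 2
C2-suc n = P.trans (P.sym (nCk+nC[k+1]≡[n+1]C[k+1] n 1)) (P.cong (ℕ._+ n C 2) (nC1≡n n))

twice-C2-suc : ∀ n → 2 ℕ.* (suc n C 2) ≡ n ℕ.+ n ℕ.+ 2 ℕ.* (n C 2)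
twice-C2-suc n = P.trans (P.cong (2 ℕ.*_) (C2-suc n)) (expand n (n C 2))
  where
  expand : ∀ n x → 2 ℕ.* (n ℕ.+ x) ≡ n ℕ.+ n ℕ.+ 2 ℕ.* x
  expand = solve-∀

C2-exponent : ∀ k j → suc j C 2 ℕ.+ (k ℕ.+ j) C 2 ≡ (k ℕ.+ j) ℕ.* j ℕ.+ k C 2
C2-exponent k zero rewrite ℕP.+-identityʳ k | ℕP.*-zeroʳ k = P.refl
C2-exponent k (suc j) = begin
  suc (suc j) C 2 ℕ.+ (k ℕ.+ suc j) C 2
    ≡⟨ P.cong (λ t → suc (suc j) C 2 ℕ.+ t C 2) (ℕP.+-suc k j) ⟩
  suc (suc j) C 2 ℕ.+ suc m C 2
    ≡⟨ P.cong₂ ℕ._+_ (C2-suc (suc j)) (C2-suc m) ⟩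
  (suc j ℕ.+ suc j C 2) ℕ.+ (m ℕ.+ m C 2)
    ≡⟨ regroup (suc j) m (suc j C 2) (m C 2) ⟩
  suc j ℕ.+ m ℕ.+ (suc j C 2 ℕ.+ m C 2)
    ≡⟨ P.cong (suc j ℕ.+ m ℕ.+_) (C2-exponent k j) ⟩
  suc j ℕ.+ m ℕ.+ (m ℕ.* j ℕ.+ k C 2)
    ≡⟨ expand j m (k C 2) ⟩
  suc m ℕ.* suc j ℕ.+ k C 2
    ≡⟨ P.cong (λ t → t ℕ.* suc j ℕ.+ k C 2) (P.sym (ℕP.+-suc k j)) ⟩
  (k ℕ.+ suc j) ℕ.* suc j ℕ.+ k C 2 ∎
  where
  open P.≡-Reasoning
  m : ℕ
  m = k ℕ.+ j
  regroup : ∀ a b x y → (a ℕ.+ x) ℕ.+ (b ℕ.+ y) ≡ a ℕ.+ b ℕ.+ (x ℕ.+ y)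
  regroup = solve-∀
  expand : ∀ j m c → suc j ℕ.+ m ℕ.+ (m ℕ.* j ℕ.+ c) ≡ suc m ℕ.* suc j ℕ.+ c
  expand = solve-∀

reflected-C2 : ∀ n k → k ≤ n → (n ℕ.+ 1 ∸ k) C 2 ℕ.+ n C 2 ≡ n ℕ.* (n ∸ k) ℕ.+ k C 2
reflected-C2 n k k≤n = begin
  (n ℕ.+ 1 ∸ k) C 2 ℕ.+ n C 2
    ≡⟨ P.cong₂ (λ a b → a C 2 ℕ.+ b C 2) n+1∸k≡1+[n∸k] (P.sym k+[n∸k]≡n) ⟩
  suc (n ∸ k) C 2 ℕ.+ (k ℕ.+ (n ∸ k)) C 2
    ≡⟨ C2-exponent k (n ∸ k) ⟩
  (k ℕ.+ (n ∸ k)) ℕ.* (n ∸ k) ℕ.+ k C 2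
    ≡⟨ P.cong (λ t → t ℕ.* (n ∸ k) ℕ.+ k C 2) k+[n∸k]≡n ⟩
  n ℕ.* (n ∸ k) ℕ.+ k C 2 ∎
  where
  open P.≡-Reasoning
  k+[n∸k]≡n : k ℕ.+ (n ∸ k) ≡ n
  k+[n∸k]≡n = ℕP.m+[n∸m]≡n k≤n
  n+1∸k≡1+[n∸k] : n ℕ.+ 1 ∸ k ≡ suc (n ∸ k)
  n+1∸k≡1+[n∸k] = P.trans (P.cong (_∸ k) (ℕP.+-comm n 1)) (ℕP.+-∸-assoc 1 k≤n)

∸-peel : ∀ {n k} → suc k ≤ n → n ∸ k ≡ suc (n ∸ suc k)
∸-peel {suc n} (s≤s k≤n) = ℕP.+-∸-assoc 1 k≤n

-- Every commutative ring receives the canonical homomorphism from ℤ.  This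
-- makes the standard library's ring solver, with integer coefficients,
-- available over any commutative ring (in particular over a field).
module IntegerCoefficients {c ℓ : Level} (R : CommutativeRing c ℓ) where
  open CommutativeRing R
  open import Relation.Binary.Reasoning.Setoid setoid
  open import Algebra.Properties.Ring ring using (-‿involutive; -‿distribˡ-*; -‿distribʳ-*; -0#≈0#)
  open import Algebra.Properties.AbelianGroup +-abelianGroup using (⁻¹-∙-comm)
  open import Algebra.Properties.CommutativeSemigroup *-commutativeSemigroup using (interchange)
  open import Algebra.Properties.Semiring.Mult.TCOptimised semiring using (1+×; ×-homo-+; ×1-homo-*)
    renaming (_×_ to _·ℕ_)

  ⟦_⟧ℕ : ℕ → Carrier
  ⟦ n ⟧ℕ = n ·ℕ 1#

  ⟦_⟧ℤ : ℤ → Carrier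
  ⟦ + n ⟧ℤ      = ⟦ n ⟧ℕ
  ⟦ -[1+ n ] ⟧ℤ = - ⟦ suc n ⟧ℕ

  x-0≈x : ∀ x → x - 0# ≈ x
  x-0≈x x = trans (+-congˡ -0#≈0#) (+-identityʳ x)

  difference-shift : ∀ x y → x - y ≈ (1# + x) - (1# + y)
  difference-shift x y = begin
    x - y                       ≈⟨ sym (+-identityˡ _) ⟩
    0# + (x - y)                ≈⟨ +-congʳ (sym (-‿inverseʳ 1#)) ⟩
    (1# - 1#) + (x - y)         ≈⟨ +-assoc _ _ _ ⟩
    1# + (- 1# + (x - y))       ≈⟨ +-congˡ (sym (+-assoc _ _ _)) ⟩
    1# + ((- 1# + x) - y)       ≈⟨ +-congˡ (+-congʳ (+-comm _ _)) ⟩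
    1# + ((x - 1#) - y)         ≈⟨ +-congˡ (+-assoc _ _ _) ⟩
    1# + (x + (- 1# + - y))     ≈⟨ sym (+-assoc _ _ _) ⟩
    (1# + x) + (- 1# + - y)     ≈⟨ +-congˡ (⁻¹-∙-comm 1# y) ⟩
    (1# + x) - (1# + y)         ∎

  ⊖-homo : ∀ m n → ⟦ m ⊖ n ⟧ℤ ≈ ⟦ m ⟧ℕ - ⟦ n ⟧ℕ
  ⊖-homo zero    zero    = sym (x-0≈x 0#)
  ⊖-homo (suc m) zero    = sym (x-0≈x _)
  ⊖-homo zero    (suc n) = sym (+-identityˡ _)
  ⊖-homo (suc m) (suc n) = begin
    ⟦ suc m ⊖ suc n ⟧ℤ              ≡⟨ P.cong ⟦_⟧ℤ (ℤP.[1+m]⊖[1+n]≡m⊖n m n) ⟩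
    ⟦ m ⊖ n ⟧ℤ                      ≈⟨ ⊖-homo m n ⟩
    ⟦ m ⟧ℕ - ⟦ n ⟧ℕ                 ≈⟨ difference-shift _ _ ⟩
    (1# + ⟦ m ⟧ℕ) - (1# + ⟦ n ⟧ℕ)   ≈⟨ sym (+-cong (1+× m 1#) (-‿cong (1+× n 1#))) ⟩
    ⟦ suc m ⟧ℕ - ⟦ suc n ⟧ℕ         ∎

  +-homo : ∀ i j → ⟦ i ℤ.+ j ⟧ℤ ≈ ⟦ i ⟧ℤ + ⟦ j ⟧ℤ
  +-homo (+ m)    (+ n)    = ×-homo-+ 1# m n
  +-homo (+ m)    -[1+ n ] = ⊖-homo m (suc n)
  +-homo -[1+ m ] (+ n)    = trans (⊖-homo n (suc m)) (+-comm _ _)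
  +-homo -[1+ m ] -[1+ n ] = begin
    - ⟦ suc (suc (m ℕ.+ n)) ⟧ℕ      ≡⟨ P.cong (λ t → - ⟦ t ⟧ℕ) (P.sym (ℕP.+-suc (suc m) n)) ⟩
    - ⟦ suc m ℕ.+ suc n ⟧ℕ          ≈⟨ -‿cong (×-homo-+ 1# (suc m) (suc n)) ⟩
    - (⟦ suc m ⟧ℕ + ⟦ suc n ⟧ℕ)     ≈⟨ sym (⁻¹-∙-comm _ _) ⟩
    - ⟦ suc m ⟧ℕ + - ⟦ suc n ⟧ℕ     ∎

  -- Multiplication is handled through the sign/absolute-value decomposition.
  ⟦_⟧sign : Sign → Carrier
  ⟦ Sign.+ ⟧sign = 1#
  ⟦ Sign.- ⟧sign = - 1#

  ◃-homo : ∀ s n → ⟦ s ℤ.◃ n ⟧ℤ ≈ ⟦ s ⟧sign * ⟦ n ⟧ℕ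
  ◃-homo s        zero    = sym (zeroʳ _)
  ◃-homo Sign.+   (suc n) = sym (*-identityˡ _)
  ◃-homo Sign.-   (suc n) = trans (-‿cong (sym (*-identityˡ _))) (-‿distribˡ-* 1# _)

  sign-homo : ∀ s t → ⟦ s Sign.* t ⟧sign ≈ ⟦ s ⟧sign * ⟦ t ⟧sign
  sign-homo Sign.+ t      = sym (*-identityˡ _)
  sign-homo Sign.- Sign.+ = sym (*-identityʳ _)
  sign-homo Sign.- Sign.- = begin
    1#              ≈⟨ sym (-‿involutive 1#) ⟩
    - - 1#          ≈⟨ -‿cong (sym (*-identityʳ _)) ⟩
    - (- 1# * 1#)   ≈⟨ -‿distribʳ-* (- 1#) 1# ⟩
    - 1# * - 1#     ∎

  sign-abs : ∀ i → ⟦ i ⟧ℤ ≈ ⟦ ℤ.sign i ⟧sign * ⟦ ℤ.∣ i ∣ ⟧ℕ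
  sign-abs i = trans (reflexive (P.cong ⟦_⟧ℤ (P.sym (ℤP.◃-inverse i)))) (◃-homo (ℤ.sign i) ℤ.∣ i ∣)

  *-homo : ∀ i j → ⟦ i ℤ.* j ⟧ℤ ≈ ⟦ i ⟧ℤ * ⟦ j ⟧ℤ
  *-homo i j = begin
    ⟦ i ℤ.* j ⟧ℤ                                     ≈⟨ ◃-homo (ℤ.sign i Sign.* ℤ.sign j) (∣i∣ ℕ.* ∣j∣) ⟩
    ⟦ ℤ.sign i Sign.* ℤ.sign j ⟧sign * ⟦ ∣i∣ ℕ.* ∣j∣ ⟧ℕ ≈⟨ *-cong (sign-homo (ℤ.sign i) (ℤ.sign j)) (×1-homo-* ∣i∣ ∣j∣) ⟩
    (s * t) * (x * y)                                ≈⟨ interchange s t x y ⟩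
    (s * x) * (t * y)                                ≈⟨ sym (*-cong (sign-abs i) (sign-abs j)) ⟩
    ⟦ i ⟧ℤ * ⟦ j ⟧ℤ                                  ∎
    where
    ∣i∣ ∣j∣ : ℕ
    ∣i∣ = ℤ.∣ i ∣
    ∣j∣ = ℤ.∣ j ∣
    s t x y : Carrier
    s = ⟦ ℤ.sign i ⟧sign
    t = ⟦ ℤ.sign j ⟧sign
    x = ⟦ ∣i∣ ⟧ℕ
    y = ⟦ ∣j∣ ⟧ℕ

  neg-homo : ∀ i → ⟦ ℤ.- i ⟧ℤ ≈ - ⟦ i ⟧ℤ
  neg-homo (+ zero)  = sym -0#≈0#
  neg-homo (+ suc n) = refl
  neg-homo -[1+ n ]  = sym (-‿involutive _)

  integer-homomorphism : ℤ.+-*-rawRing -Raw-AlmostCommutative⟶ fromCommutativeRing R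
  integer-homomorphism = record
    { ⟦_⟧ = ⟦_⟧ℤ ; +-homo = +-homo ; *-homo = *-homo ; -‿homo = neg-homo
    ; 0-homo = refl ; 1-homo = refl }

  equal-integers? : ∀ i j → Maybe (⟦ i ⟧ℤ ≈ ⟦ j ⟧ℤ)
  equal-integers? i j with i ℤ.≟ j
  ... | yes i≡j = just (reflexive (P.cong ⟦_⟧ℤ i≡j))
  ... | no _    = nothing

  open import Algebra.Solver.Ring ℤ.+-*-rawRing (fromCommutativeRing R) integer-homomorphism equal-integers? public
    using (solve; _:=_; _:+_; _:*_; :-_; _:-_; con)

module QCalculus {c ℓ : Level} (F : Field c ℓ) where
  open Field F
  open QDefs F
  open IntegerCoefficients commutativeRing
  open import Relation.Binary.Reasoning.Setoid setoid
  open import Algebra.Properties.Ring ring using (-‿involutive; -‿distribˡ-*; -0#≈0#)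
  open import Algebra.Properties.CommutativeSemigroup *-commutativeSemigroup
    using (interchange; x∙yz≈y∙xz; x∙yz≈xz∙y; xy∙z≈xz∙y)

  Nonzero : Carrier → Set ℓ
  Nonzero x = ¬ (x ≈ 0#)

  ⁻¹-inverseˡ : ∀ {x} → Nonzero x → x ⁻¹ * x ≈ 1#
  ⁻¹-inverseˡ {x} x≉0 = trans (*-comm _ _) (⁻¹-inverse x x≉0)

  ⁻¹-cancelˡ : ∀ {x} y → Nonzero x → x ⁻¹ * (x * y) ≈ y
  ⁻¹-cancelˡ {x} y x≉0 = begin
    x ⁻¹ * (x * y)   ≈⟨ sym (*-assoc _ _ _) ⟩
    (x ⁻¹ * x) * y   ≈⟨ *-congʳ (⁻¹-inverseˡ x≉0) ⟩
    1# * y           ≈⟨ *-identityˡ y ⟩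
    y                ∎

  *-cancelˡ : ∀ {x y z} → Nonzero x → x * y ≈ x * z → y ≈ z
  *-cancelˡ {x} {y} {z} x≉0 xy≈xz = begin
    y                ≈⟨ sym (⁻¹-cancelˡ y x≉0) ⟩
    x ⁻¹ * (x * y)   ≈⟨ *-congˡ xy≈xz ⟩
    x ⁻¹ * (x * z)   ≈⟨ ⁻¹-cancelˡ z x≉0 ⟩
    z                ∎

  *-nonzero : ∀ {x y} → Nonzero x → Nonzero y → Nonzero (x * y)
  *-nonzero {x} {y} x≉0 y≉0 xy≈0 = y≉0 (*-cancelˡ x≉0 (trans xy≈0 (sym (zeroʳ x))))

  nonzero-factorˡ : ∀ {x y} → Nonzero (x * y) → Nonzero x
  nonzero-factorˡ xy≉0 x≈0 = xy≉0 (trans (*-congʳ x≈0) (zeroˡ _))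

  nonzero-cong : ∀ {x y} → x ≈ y → Nonzero x → Nonzero y
  nonzero-cong x≈y x≉0 y≈0 = x≉0 (trans x≈y y≈0)

  -‿nonzero : ∀ {x} → Nonzero x → Nonzero (- x)
  -‿nonzero x≉0 -x≈0 = x≉0 (trans (sym (-‿involutive _)) (trans (-‿cong -x≈0) -0#≈0#))

  ⁻¹-unique : ∀ {x y} → Nonzero x → x * y ≈ 1# → x ⁻¹ ≈ y
  ⁻¹-unique {x} {y} x≉0 xy≈1 = begin
    x ⁻¹              ≈⟨ sym (*-identityʳ _) ⟩
    x ⁻¹ * 1#         ≈⟨ *-congˡ (sym xy≈1) ⟩
    x ⁻¹ * (x * y)    ≈⟨ ⁻¹-cancelˡ y x≉0 ⟩
    y                 ∎

  ⁻¹-distrib-* : ∀ {x y} → Nonzero x → Nonzero y → (x * y) ⁻¹ ≈ x ⁻¹ * y ⁻¹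
  ⁻¹-distrib-* {x} {y} x≉0 y≉0 = ⁻¹-unique (*-nonzero x≉0 y≉0) (begin
    (x * y) * (x ⁻¹ * y ⁻¹)    ≈⟨ interchange x y (x ⁻¹) (y ⁻¹) ⟩
    (x * x ⁻¹) * (y * y ⁻¹)    ≈⟨ *-cong (⁻¹-inverse x x≉0) (⁻¹-inverse y y≉0) ⟩
    1# * 1#                    ≈⟨ *-identityˡ 1# ⟩
    1#                         ∎)

  divide : ∀ {a b d} → Nonzero d → a * d ≈ b → a ≈ b * d ⁻¹
  divide {a} {b} {d} d≉0 ad≈b = begin
    a                 ≈⟨ sym (⁻¹-cancelˡ a d≉0) ⟩
    d ⁻¹ * (d * a)    ≈⟨ *-congˡ (trans (*-comm d a) ad≈b) ⟩
    d ⁻¹ * b          ≈⟨ *-comm _ _ ⟩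
    b * d ⁻¹          ∎

  pow-≡ : ∀ x {a b} → a ≡ b → pow x a ≈ pow x b
  pow-≡ x a≡b = reflexive (P.cong (pow x) a≡b)

  pow-cong : ∀ {x y} n → x ≈ y → pow x n ≈ pow y n
  pow-cong zero    x≈y = refl
  pow-cong (suc n) x≈y = *-cong x≈y (pow-cong n x≈y)

  pow-one : ∀ n → pow 1# n ≈ 1#
  pow-one zero    = refl
  pow-one (suc n) = trans (*-congˡ (pow-one n)) (*-identityˡ _)

  pow-+ : ∀ x a b → pow x (a ℕ.+ b) ≈ pow x a * pow x b
  pow-+ x zero    b = sym (*-identityˡ _)
  pow-+ x (suc a) b = trans (*-congˡ (pow-+ x a b)) (sym (*-assoc _ _ _))

  pow-distrib : ∀ x y n → pow (x * y) n ≈ pow x n * pow y n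
  pow-distrib x y zero    = sym (*-identityˡ _)
  pow-distrib x y (suc n) = trans (*-congˡ (pow-distrib x y n)) (interchange x y (pow x n) (pow y n))

  pow-* : ∀ x a b → pow x (a ℕ.* b) ≈ pow (pow x a) b
  pow-* x zero    b = sym (pow-one b)
  pow-* x (suc a) b = begin
    pow x (b ℕ.+ a ℕ.* b)        ≈⟨ pow-+ x b (a ℕ.* b) ⟩
    pow x b * pow x (a ℕ.* b)    ≈⟨ *-congˡ (pow-* x a b) ⟩
    pow x b * pow (pow x a) b    ≈⟨ sym (pow-distrib x (pow x a) b) ⟩
    pow (x * pow x a) b          ∎

  pow-swap : ∀ x a b → pow (pow x a) b ≈ pow (pow x b) a
  pow-swap x a b = trans (sym (pow-* x a b)) (trans (pow-≡ x (ℕP.*-comm a b)) (pow-* x b a))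

  pow-nonzero : ∀ {x} n → Nonzero x → Nonzero (pow x n)
  pow-nonzero zero    x≉0 1≈0 = x≉0 (trans (sym (*-identityʳ _)) (trans (*-congˡ 1≈0) (zeroʳ _)))
  pow-nonzero (suc n) x≉0 = *-nonzero x≉0 (pow-nonzero n x≉0)

  poch-≡ : ∀ z q {a b} → a ≡ b → poch z q a ≈ poch z q b
  poch-≡ z q a≡b = reflexive (P.cong (poch z q) a≡b)

  poch-cong : ∀ {z z'} q N → z ≈ z' → poch z q N ≈ poch z' q N
  poch-cong q zero    z≈z' = refl
  poch-cong q (suc N) z≈z' = *-cong (poch-cong q N z≈z') (+-congˡ (-‿cong (*-congʳ z≈z')))

  poch-+ : ∀ z q a b → poch z q (a ℕ.+ b) ≈ poch z q a * poch (z * pow q a) q b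
  poch-+ z q a zero = trans (poch-≡ z q (ℕP.+-identityʳ a)) (sym (*-identityʳ _))
  poch-+ z q a (suc b) = begin
    poch z q (a ℕ.+ suc b)                        ≈⟨ poch-≡ z q (ℕP.+-suc a b) ⟩
    poch z q (a ℕ.+ b) * (1# - z * pow q (a ℕ.+ b))
      ≈⟨ *-cong (poch-+ z q a b) (+-congˡ (-‿cong (*-congˡ (pow-+ q a b)))) ⟩
    (Pa * Pb) * (1# - z * (qᵃ * qᵇ))
      ≈⟨ solve 5 (λ Pa Pb z qa qb → (Pa :* Pb) :* (con (+ 1) :- z :* (qa :* qb)) := Pa :* (Pb :* (con (+ 1) :- (z :* qa) :* qb))) refl Pa Pb z qᵃ qᵇ ⟩
    Pa * (Pb * (1# - (z * qᵃ) * qᵇ))              ∎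
    where
    Pa Pb qᵃ qᵇ : Carrier
    Pa = poch z q a
    Pb = poch (z * pow q a) q b
    qᵃ = pow q a
    qᵇ = pow q b

  poch-suc : ∀ z q N → poch z q (suc N) ≈ (1# - z) * poch (z * q) q N
  poch-suc z q N = begin
    poch z q (1 ℕ.+ N)                                   ≈⟨ poch-+ z q 1 N ⟩
    (1# * (1# - z * 1#)) * poch (z * (q * 1#)) q N
      ≈⟨ *-cong (trans (*-identityˡ _) (+-congˡ (-‿cong (*-identityʳ z)))) (poch-cong q N (*-congˡ (*-identityʳ q))) ⟩
    (1# - z) * poch (z * q) q N                          ∎

  -- Both sides are (z;q)_{a+b}.
  poch-swap : ∀ z q a b → poch z q a * poch (z * pow q a) q b ≈ poch z q b * poch (z * pow q b) q a
  poch-swap z q a b = begin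
    poch z q a * poch (z * pow q a) q b   ≈⟨ sym (poch-+ z q a b) ⟩
    poch z q (a ℕ.+ b)                    ≈⟨ poch-≡ z q (ℕP.+-comm a b) ⟩
    poch z q (b ℕ.+ a)                    ≈⟨ poch-+ z q b a ⟩
    poch z q b * poch (z * pow q b) q a   ∎

  sum-cong : ∀ n {f g : ℕ → Carrier} → (∀ k → k ≤ n → f k ≈ g k) → sumTo n f ≈ sumTo n g
  sum-cong zero    f≈g = f≈g 0 z≤n
  sum-cong (suc n) f≈g = +-cong (sum-cong n (λ k k≤n → f≈g k (ℕP.m≤n⇒m≤1+n k≤n))) (f≈g (suc n) ℕP.≤-refl)

  sum-+ : ∀ n (f g : ℕ → Carrier) → sumTo n (λ k → f k + g k) ≈ sumTo n f + sumTo n g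
  sum-+ zero    f g = refl
  sum-+ (suc n) f g = trans (+-congʳ (sum-+ n f g))
    (solve 4 (λ a b u v → (a :+ b) :+ (u :+ v) := (a :+ u) :+ (b :+ v)) refl (sumTo n f) (sumTo n g) (f (suc n)) (g (suc n)))

  sum-scale : ∀ n a (f : ℕ → Carrier) → sumTo n (λ k → a * f k) ≈ a * sumTo n f
  sum-scale zero    a f = refl
  sum-scale (suc n) a f = trans (+-congʳ (sum-scale n a f)) (sym (distribˡ _ _ _))

  sum-factor : ∀ n K (w f : ℕ → Carrier) → sumTo n (λ k → w k * (K * f k)) ≈ K * sumTo n (λ k → w k * f k)
  sum-factor n K w f = trans (sum-cong n (λ k _ → x∙yz≈y∙xz (w k) K (f k))) (sum-scale n K _)

  sum-shift : ∀ n (f : ℕ → Carrier) → sumTo (suc n) f ≈ f 0 + sumTo n (λ k → f (suc k))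
  sum-shift zero    f = refl
  sum-shift (suc n) f = trans (+-congʳ (sum-shift n f)) (+-assoc _ _ _)

  module Gaussian (q : Carrier) where

    gauss : ℕ → ℕ → Carrier
    gauss zero    zero    = 1#
    gauss zero    (suc k) = 0#
    gauss (suc n) zero    = 1#
    gauss (suc n) (suc k) = gauss n (suc k) + pow q (n ∸ k) * gauss n k

    gauss-zero : ∀ n → gauss n 0 ≡ 1#
    gauss-zero zero    = P.refl
    gauss-zero (suc n) = P.refl

    gauss-vanish : ∀ n k → n < k → gauss n k ≈ 0#
    gauss-vanish zero    (suc k) _         = refl
    gauss-vanish (suc n) (suc k) (s≤s n<k) = begin
      gauss n (suc k) + pow q (n ∸ k) * gauss n k
        ≈⟨ +-cong (gauss-vanish n (suc k) (ℕP.m≤n⇒m≤1+n n<k)) (*-congˡ (gauss-vanish n k n<k)) ⟩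
      0# + pow q (n ∸ k) * 0#   ≈⟨ trans (+-identityˡ _) (zeroʳ _) ⟩
      0#                        ∎

    qⁿ-split : ∀ n k → k ≤ n → pow q n ≈ pow q (n ∸ k) * pow q k
    qⁿ-split n k k≤n = trans (pow-≡ q (P.sym (ℕP.m∸n+n≡m k≤n))) (pow-+ q (n ∸ k) k)

    pow-C2-suc : ∀ j → pow q (suc j C 2) ≈ pow q j * pow q (j C 2)
    pow-C2-suc j = trans (pow-≡ q (C2-suc j)) (pow-+ q j (j C 2))

    pow-twice-C2-suc : ∀ j → pow q (2 ℕ.* (suc j C 2)) ≈ pow q j * pow q j * pow q (2 ℕ.* (j C 2))
    pow-twice-C2-suc j = begin
      pow q (2 ℕ.* (suc j C 2))                        ≈⟨ pow-≡ q (twice-C2-suc j) ⟩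
      pow q (j ℕ.+ j ℕ.+ 2 ℕ.* (j C 2))                ≈⟨ pow-+ q (j ℕ.+ j) _ ⟩
      pow q (j ℕ.+ j) * pow q (2 ℕ.* (j C 2))          ≈⟨ *-congʳ (pow-+ q j j) ⟩
      pow q j * pow q j * pow q (2 ℕ.* (j C 2))        ∎

    pascal-sum : ∀ n (X : ℕ → Carrier) →
      sumTo (suc n) (λ k → gauss (suc n) k * X k)
        ≈ sumTo n (λ k → gauss n k * X k) + sumTo n (λ j → (pow q (n ∸ j) * gauss n j) * X (suc j))
    pascal-sum n X = begin
      sumTo (suc n) (λ k → gauss (suc n) k * X k)
        ≈⟨ sum-shift n _ ⟩
      1# * X 0 + sumTo n (λ j → (gauss n (suc j) + pow q (n ∸ j) * gauss n j) * X (suc j))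
        ≈⟨ +-congˡ (trans (sum-cong n (λ j _ → distribʳ _ _ _)) (sum-+ n _ _)) ⟩
      1# * X 0 + (sumTo n (λ j → gauss n (suc j) * X (suc j)) + T)
        ≈⟨ sym (+-assoc _ _ _) ⟩
      (1# * X 0 + sumTo n (λ j → gauss n (suc j) * X (suc j))) + T
        ≈⟨ +-congʳ (+-congʳ (*-congʳ (reflexive (P.sym (gauss-zero n))))) ⟩
      (gauss n 0 * X 0 + sumTo n (λ j → gauss n (suc j) * X (suc j))) + T
        ≈⟨ +-congʳ (sym (sum-shift n (λ k → gauss n k * X k))) ⟩
      (sumTo n (λ k → gauss n k * X k) + gauss n (suc n) * X (suc n)) + T
        ≈⟨ +-congʳ (+-congˡ (trans (*-congʳ (gauss-vanish n (suc n) ℕP.≤-refl)) (zeroˡ _))) ⟩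
      (sumTo n (λ k → gauss n k * X k) + 0#) + T
        ≈⟨ +-congʳ (+-identityʳ _) ⟩
      sumTo n (λ k → gauss n k * X k) + T ∎
      where
      T : Carrier
      T = sumTo n (λ j → (pow q (n ∸ j) * gauss n j) * X (suc j))

    gauss-factorial : ∀ n k → k ≤ n → poch q q n ≈ gauss n k * (poch q q k * poch q q (n ∸ k))
    gauss-factorial zero    zero    _ = sym (trans (*-identityˡ _) (*-identityˡ _))
    gauss-factorial (suc n) zero    _ = sym (trans (*-identityˡ _) (*-identityˡ _))
    gauss-factorial (suc n) (suc k) (s≤s k≤n) = sym (begin
      (gauss n (suc k) + A * gauss n k) * (Pk * (1# - q * qᵏ) * Pnk)
        ≈⟨ distribʳ _ _ _ ⟩
      gauss n (suc k) * (Pk * (1# - q * qᵏ) * Pnk) + (A * gauss n k) * (Pk * (1# - q * qᵏ) * Pnk)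
        ≈⟨ +-cong upper (solve 6 (λ A g Pk q qk Pnk → (A :* g) :* (Pk :* (con (+ 1) :- q :* qk) :* Pnk)
                                  := (A :* (con (+ 1) :- q :* qk)) :* (g :* (Pk :* Pnk))) refl A (gauss n k) Pk q qᵏ Pnk) ⟩
      Pn * (1# - A) + (A * (1# - q * qᵏ)) * (gauss n k * (Pk * Pnk))
        ≈⟨ +-congˡ (*-congˡ (sym (gauss-factorial n k k≤n))) ⟩
      Pn * (1# - A) + (A * (1# - q * qᵏ)) * Pn
        ≈⟨ solve 4 (λ Pn A q qk → Pn :* (con (+ 1) :- A) :+ (A :* (con (+ 1) :- q :* qk)) :* Pn
                                  := Pn :* (con (+ 1) :- q :* (A :* qk))) refl Pn A q qᵏ ⟩
      Pn * (1# - q * (A * qᵏ))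
        ≈⟨ *-congˡ (+-congˡ (-‿cong (*-congˡ (sym (qⁿ-split n k k≤n))))) ⟩
      Pn * (1# - q * pow q n) ∎)
      where
      A Pk qᵏ Pnk Pn : Carrier
      A   = pow q (n ∸ k)
      Pk  = poch q q k
      qᵏ  = pow q k
      Pnk = poch q q (n ∸ k)
      Pn  = poch q q n
      -- the term with gauss n (k+1), which vanishes when k = n
      upper : gauss n (suc k) * (Pk * (1# - q * qᵏ) * Pnk) ≈ Pn * (1# - A)
      upper with ℕP.m≤n⇒m<n∨m≡n k≤n
      ... | inj₁ k<n = begin
        gauss n (suc k) * (Pk * (1# - q * qᵏ) * Pnk)
          ≈⟨ *-congˡ (*-congˡ (poch-≡ q q n∸k≡1+[n∸1+k])) ⟩
        gauss n (suc k) * (Pk * (1# - q * qᵏ) * (Pm * (1# - q * pow q (n ∸ suc k))))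
          ≈⟨ solve 6 (λ g Pk q qk Pm B → g :* (Pk :* (con (+ 1) :- q :* qk) :* (Pm :* (con (+ 1) :- B)))
                                   := (g :* (Pk :* (con (+ 1) :- q :* qk) :* Pm)) :* (con (+ 1) :- B))
                     refl (gauss n (suc k)) Pk q qᵏ Pm (q * pow q (n ∸ suc k)) ⟩
        (gauss n (suc k) * (Pk * (1# - q * qᵏ) * Pm)) * (1# - q * pow q (n ∸ suc k))
          ≈⟨ *-cong (sym (gauss-factorial n (suc k) k<n)) (+-congˡ (-‿cong (pow-≡ q (P.sym n∸k≡1+[n∸1+k])))) ⟩
        Pn * (1# - A) ∎
        where
        Pm : Carrier
        Pm = poch q q (n ∸ suc k)
        n∸k≡1+[n∸1+k] : n ∸ k ≡ suc (n ∸ suc k)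
        n∸k≡1+[n∸1+k] = ∸-peel k<n
      ... | inj₂ P.refl = begin
        gauss k (suc k) * (Pk * (1# - q * qᵏ) * Pnk)
          ≈⟨ trans (*-congʳ (gauss-vanish k (suc k) ℕP.≤-refl)) (zeroˡ _) ⟩
        0#              ≈⟨ sym (zeroʳ _) ⟩
        Pn * 0#         ≈⟨ *-congˡ (sym (-‿inverseʳ 1#)) ⟩
        Pn * (1# - 1#)  ≈⟨ *-congˡ (+-congˡ (-‿cong (pow-≡ q (P.sym (ℕP.n∸n≡0 k))))) ⟩
        Pn * (1# - A)   ∎

    qbin≈gauss : (∀ m → Nonzero (poch q q m)) → ∀ n k → k ≤ n → qbin q n k ≈ gauss n k
    qbin≈gauss qq≉0 n k k≤n = begin
      poch q q n * D ⁻¹         ≈⟨ *-congʳ (gauss-factorial n k k≤n) ⟩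
      (gauss n k * D) * D ⁻¹    ≈⟨ *-assoc _ _ _ ⟩
      gauss n k * (D * D ⁻¹)    ≈⟨ *-congˡ (⁻¹-inverse D (*-nonzero (qq≉0 k) (qq≉0 (n ∸ k)))) ⟩
      gauss n k * 1#            ≈⟨ *-identityʳ _ ⟩
      gauss n k                 ∎
      where
      D : Carrier
      D = poch q q k * poch q q (n ∸ k)

    q-binomial : ∀ n z → sumTo n (λ k → gauss n k * (pow (- z) k * pow q (k C 2))) ≈ poch z q n
    q-binomial zero    z = trans (*-identityˡ _) (*-identityˡ _)
    q-binomial (suc n) z = begin
      sumTo (suc n) (λ k → gauss (suc n) k * Y k)
        ≈⟨ pascal-sum n Y ⟩
      B + sumTo n (λ j → (pow q (n ∸ j) * gauss n j) * Y (suc j))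
        ≈⟨ +-congˡ (trans (sum-cong n step) (sum-scale n _ _)) ⟩
      B + (- z * pow q n) * B
        ≈⟨ solve 3 (λ B z Q → B :+ (:- z :* Q) :* B := B :* (con (+ 1) :- z :* Q)) refl B z (pow q n) ⟩
      B * (1# - z * pow q n)
        ≈⟨ *-congʳ (q-binomial n z) ⟩
      poch z q n * (1# - z * pow q n) ∎
      where
      Y : ℕ → Carrier
      Y k = pow (- z) k * pow q (k C 2)
      B : Carrier
      B = sumTo n (λ k → gauss n k * Y k)
      step : ∀ j → j ≤ n → (pow q (n ∸ j) * gauss n j) * Y (suc j) ≈ (- z * pow q n) * (gauss n j * Y j)
      step j j≤n = begin
        (A * g) * ((- z * w) * pow q (suc j C 2))    ≈⟨ *-congˡ (*-congˡ (pow-C2-suc j)) ⟩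
        (A * g) * ((- z * w) * (qʲ * Cj))
          ≈⟨ solve 6 (λ A g z w J Cj → (A :* g) :* ((:- z :* w) :* (J :* Cj)) := (:- z :* (A :* J)) :* (g :* (w :* Cj))) refl A g z w qʲ Cj ⟩
        (- z * (A * qʲ)) * (g * (w * Cj))            ≈⟨ *-congʳ (*-congˡ (sym (qⁿ-split n j j≤n))) ⟩
        (- z * pow q n) * (gauss n j * Y j)          ∎
        where
        A g w qʲ Cj : Carrier
        A  = pow q (n ∸ j)
        g  = gauss n j
        w  = pow (- z) j
        qʲ = pow q j
        Cj = pow q (j C 2)

    inverseTerm : ℕ → Carrier → ℕ → Carrier
    inverseTerm n z k = pow z k * pow q (2 ℕ.* (k C 2)) * poch (z * pow q k) q (n ∸ k)

    inverseTerm-lower : ∀ n z k → k ≤ n →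
      gauss n k * inverseTerm (suc n) z k ≈ (1# - z * pow q n) * (gauss n k * inverseTerm n z k)
    inverseTerm-lower n z k k≤n = begin
      g * (w * Ck * poch (z * qᵏ) q (suc n ∸ k))
        ≈⟨ *-congˡ (*-congˡ (poch-≡ (z * qᵏ) q (ℕP.+-∸-assoc 1 k≤n))) ⟩
      g * (w * Ck * (Pz * (1# - (z * qᵏ) * A)))
        ≈⟨ solve 7 (λ g w Ck Pz z Qk A → g :* (w :* Ck :* (Pz :* (con (+ 1) :- (z :* Qk) :* A)))
                                  := (con (+ 1) :- z :* (A :* Qk)) :* (g :* (w :* Ck :* Pz))) refl g w Ck Pz z qᵏ A ⟩
      (1# - z * (A * qᵏ)) * (g * (w * Ck * Pz))
        ≈⟨ *-congʳ (+-congˡ (-‿cong (*-congˡ (sym (qⁿ-split n k k≤n))))) ⟩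
      (1# - z * pow q n) * (gauss n k * inverseTerm n z k) ∎
      where
      g w Ck Pz qᵏ A : Carrier
      g  = gauss n k
      w  = pow z k
      Ck = pow q (2 ℕ.* (k C 2))
      Pz = poch (z * pow q k) q (n ∸ k)
      qᵏ = pow q k
      A  = pow q (n ∸ k)

    inverseTerm-upper : ∀ n z j → j ≤ n →
      (pow q (n ∸ j) * gauss n j) * inverseTerm (suc n) z (suc j) ≈ (z * pow q n) * (gauss n j * inverseTerm n (z * q) j)
    inverseTerm-upper n z j j≤n = begin
      (A * g) * (z * w * pow q (2 ℕ.* (suc j C 2)) * poch (z * (q * qʲ)) q (n ∸ j))
        ≈⟨ *-congˡ (*-cong (*-congˡ (pow-twice-C2-suc j)) (poch-cong q (n ∸ j) (sym (*-assoc _ _ _)))) ⟩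
      (A * g) * (z * w * (qʲ * qʲ * Cj) * Pz)
        ≈⟨ solve 7 (λ A g z w J Cj Pz → (A :* g) :* (z :* w :* (J :* J :* Cj) :* Pz)
                                  := (z :* (A :* J)) :* (g :* (w :* J :* Cj :* Pz))) refl A g z w qʲ Cj Pz ⟩
      (z * (A * qʲ)) * (g * (w * qʲ * Cj * Pz))
        ≈⟨ *-cong (*-congˡ (sym (qⁿ-split n j j≤n))) (*-congˡ (*-congʳ (*-congʳ (sym (pow-distrib z q j))))) ⟩
      (z * pow q n) * (gauss n j * inverseTerm n (z * q) j) ∎
      where
      A g w qʲ Cj Pz : Carrier
      A  = pow q (n ∸ j)
      g  = gauss n j
      w  = pow z j
      qʲ = pow q j
      Cj = pow q (2 ℕ.* (j C 2))
      Pz = poch ((z * q) * qʲ) q (n ∸ j)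

    -- The inverse relation: Σ_k [n k] z^k q^{2 binom(k,2)} (zq^k;q)_{n-k} = 1,
    -- by induction on n, the two halves combining as (1 - zq^n) + zq^n.
    inverse-sum : ∀ n z → sumTo n (λ k → gauss n k * inverseTerm n z k) ≈ 1#
    inverse-sum zero    z = trans (*-identityˡ _) (trans (*-identityʳ _) (*-identityˡ _))
    inverse-sum (suc n) z = begin
      sumTo (suc n) (λ k → gauss (suc n) k * inverseTerm (suc n) z k)
        ≈⟨ pascal-sum n (inverseTerm (suc n) z) ⟩
      sumTo n (λ k → gauss n k * inverseTerm (suc n) z k)
        + sumTo n (λ j → (pow q (n ∸ j) * gauss n j) * inverseTerm (suc n) z (suc j))
        ≈⟨ +-cong (sum-cong n (inverseTerm-lower n z)) (sum-cong n (inverseTerm-upper n z)) ⟩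
      sumTo n (λ k → (1# - zqⁿ) * (gauss n k * inverseTerm n z k))
        + sumTo n (λ j → zqⁿ * (gauss n j * inverseTerm n (z * q) j))
        ≈⟨ +-cong (sum-scale n _ _) (sum-scale n _ _) ⟩
      (1# - zqⁿ) * sumTo n (λ k → gauss n k * inverseTerm n z k)
        + zqⁿ * sumTo n (λ j → gauss n j * inverseTerm n (z * q) j)
        ≈⟨ +-cong (*-congˡ (inverse-sum n z)) (*-congˡ (inverse-sum n (z * q))) ⟩
      (1# - zqⁿ) * 1# + zqⁿ * 1#
        ≈⟨ solve 1 (λ x → (con (+ 1) :- x) :* con (+ 1) :+ x :* con (+ 1) := con (+ 1)) refl zqⁿ ⟩
      1# ∎
      where
      zqⁿ : Carrier
      zqⁿ = z * pow q n

    reversal : Nonzero q → ∀ n d e → e * (d * pow q n) ≈ q →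
      poch e q n * (pow (- d) n * pow q (n C 2)) ≈ poch d q n
    reversal q≉0 zero    d e _ = trans (*-identityˡ _) (*-identityˡ _)
    reversal q≉0 (suc n) d e edqⁿ⁺¹≈q = begin
      poch e q (suc n) * (pow (- d) (suc n) * pow q (suc n C 2))
        ≈⟨ *-cong (poch-suc e q n) (*-congˡ (pow-C2-suc n)) ⟩
      ((1# - e) * poch (e * q) q n) * ((- d * w) * (qⁿ * Cn))
        ≈⟨ solve 6 (λ e P d w Q Cn → ((con (+ 1) :- e) :* P) :* ((:- d :* w) :* (Q :* Cn))
                               := ((con (+ 1) :- e) :* (:- (d :* Q))) :* (P :* (w :* Cn))) refl e (poch (e * q) q n) d w qⁿ Cn ⟩
      ((1# - e) * (- D)) * (poch (e * q) q n * (w * Cn))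
        ≈⟨ *-congˡ (reversal q≉0 n d (e * q) eqD≈q) ⟩
      ((1# - e) * (- D)) * poch d q n
        ≈⟨ *-congʳ (solve 2 (λ e D → (con (+ 1) :- e) :* (:- D) := e :* D :- D) refl e D) ⟩
      (e * D - D) * poch d q n
        ≈⟨ trans (*-congʳ (+-congʳ eD≈1)) (*-comm _ _) ⟩
      poch d q n * (1# - d * pow q n) ∎
      where
      qⁿ Cn w D : Carrier
      qⁿ = pow q n
      Cn = pow q (n C 2)
      w  = pow (- d) n
      D  = d * qⁿ
      eqD≈q : (e * q) * D ≈ q
      eqD≈q = trans (solve 4 (λ e q d Q → (e :* q) :* (d :* Q) := e :* (d :* (q :* Q))) refl e q d qⁿ) edqⁿ⁺¹≈q
      eD≈1 : e * D ≈ 1#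
      eD≈1 = *-cancelˡ q≉0 (begin
        q * (e * D)   ≈⟨ solve 4 (λ q e d Q → q :* (e :* (d :* Q)) := e :* (d :* (q :* Q))) refl q e d qⁿ ⟩
        e * (d * pow q (suc n)) ≈⟨ edqⁿ⁺¹≈q ⟩
        q             ≈⟨ sym (*-identityʳ q) ⟩
        q * 1#        ∎)

  -- With d = γ q^{-n} the coefficient
  -- of total degree N reduces to
  --   (d;q)_N⁻¹ = (q/γ;q)_n⁻¹ Σ_k [n k] (-γ)^{k-n} q^{binom(n+1-k,2)} q^{kN} (γ;q)_N⁻¹,
  -- which follows from (d;q)_N (dq^N;q)_n = (d;q)_n (γ;q)_N, the q-binomial
  -- expansion of (dq^N;q)_n and the reversal (d;q)_n = (q/γ;q)_n (-d)^n q^{binom(n,2)}.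
  module FirstIdentity (q γ : Carrier) (n N : ℕ)
      (q≉0 : Nonzero q) (γ≉0 : Nonzero γ) (qq≉0 : ∀ m → Nonzero (poch q q m))
      (γ-poch≉0 : Nonzero (poch γ q N))
      (d-poch≉0 : Nonzero (poch (γ * pow (q ⁻¹) n) q N))
      (S≉0 : Nonzero (poch (q * (γ ⁻¹)) q n)) where
    open Gaussian q

    d : Carrier
    d = γ * pow (q ⁻¹) n

    S G H M : Carrier
    S = poch (q * (γ ⁻¹)) q n
    G = poch γ q N
    H = poch d q N
    M = poch (d * pow q N) q n

    -- the factor produced by reversing (d;q)_n
    A : Carrier
    A = pow (- d) n * pow q (n C 2)

    weight : ℕ → Carrier
    weight k = qbin q n k * (pow (- γ) (n ∸ k) ⁻¹) * pow q ((n ℕ.+ 1 ∸ k) C 2)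

    binomialTerm : ℕ → Carrier
    binomialTerm k = gauss n k * (pow (- (d * pow q N)) k * pow q (k C 2))

    dqⁿ≈γ : d * pow q n ≈ γ
    dqⁿ≈γ = begin
      (γ * pow (q ⁻¹) n) * pow q n   ≈⟨ *-assoc _ _ _ ⟩
      γ * (pow (q ⁻¹) n * pow q n)   ≈⟨ *-congˡ (sym (pow-distrib (q ⁻¹) q n)) ⟩
      γ * pow (q ⁻¹ * q) n           ≈⟨ *-congˡ (trans (pow-cong n (⁻¹-inverseˡ q≉0)) (pow-one n)) ⟩
      γ * 1#                         ≈⟨ *-identityʳ γ ⟩
      γ                              ∎

    d≉0 : Nonzero d
    d≉0 = nonzero-factorˡ (nonzero-cong (sym dqⁿ≈γ) γ≉0)

    A≉0 : Nonzero A
    A≉0 = *-nonzero (pow-nonzero n (-‿nonzero d≉0)) (pow-nonzero (n C 2) q≉0)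

    -- Reversal gives (d;q)_n = (q/γ;q)_n (-d)^n q^{binom(n,2)}, since (q/γ) · dq^n = q.
    d-poch-reversed : S * A ≈ poch d q n
    d-poch-reversed = reversal q≉0 n d (q * γ ⁻¹) (begin
      (q * γ ⁻¹) * (d * pow q n)   ≈⟨ *-congˡ dqⁿ≈γ ⟩
      (q * γ ⁻¹) * γ               ≈⟨ *-assoc _ _ _ ⟩
      q * (γ ⁻¹ * γ)               ≈⟨ *-congˡ (⁻¹-inverseˡ γ≉0) ⟩
      q * 1#                       ≈⟨ *-identityʳ q ⟩
      q                            ∎)

    -- both sides are (d;q)_{N+n}
    HM≈d-poch·G : H * M ≈ poch d q n * G
    HM≈d-poch·G = trans (poch-swap d q N n) (*-congˡ (poch-cong q N dqⁿ≈γ))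

    exponents : ∀ k → k ≤ n → pow q ((n ℕ.+ 1 ∸ k) C 2) * pow q (n C 2) ≈ pow (pow q n) (n ∸ k) * pow q (k C 2)
    exponents k k≤n = begin
      pow q ((n ℕ.+ 1 ∸ k) C 2) * pow q (n C 2)  ≈⟨ sym (pow-+ q ((n ℕ.+ 1 ∸ k) C 2) (n C 2)) ⟩
      pow q ((n ℕ.+ 1 ∸ k) C 2 ℕ.+ n C 2)        ≈⟨ pow-≡ q (reflected-C2 n k k≤n) ⟩
      pow q (n ℕ.* (n ∸ k) ℕ.+ k C 2)            ≈⟨ pow-+ q (n ℕ.* (n ∸ k)) (k C 2) ⟩
      pow q (n ℕ.* (n ∸ k)) * pow q (k C 2)      ≈⟨ *-congʳ (pow-* q n (n ∸ k)) ⟩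
      pow (pow q n) (n ∸ k) * pow q (k C 2)      ∎

    weight-term : ∀ k → k ≤ n → weight k * pow (pow q k) N * A ≈ binomialTerm k
    weight-term k k≤n = begin
      qbin q n k * E ⁻¹ * C' * pow (pow q k) N * (pow (- d) n * Cn)
        ≈⟨ *-cong (*-cong (*-congʳ (*-congʳ (qbin≈gauss qq≉0 n k k≤n))) (pow-swap q k N))
                  (*-congʳ (trans (pow-≡ (- d) (P.sym (ℕP.m∸n+n≡m k≤n))) (pow-+ (- d) (n ∸ k) k))) ⟩
      g * E ⁻¹ * C' * QNk * ((Dj * Dk) * Cn)
        ≈⟨ solve 7 (λ g e C' Q Dj Dk Cn → g :* e :* C' :* Q :* ((Dj :* Dk) :* Cn)
                                    := g :* (e :* (Dj :* (C' :* Cn) :* (Dk :* Q)))) refl g (E ⁻¹) C' QNk Dj Dk Cn ⟩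
      g * (E ⁻¹ * (Dj * (C' * Cn) * (Dk * QNk)))
        ≈⟨ *-congˡ (*-congˡ (*-congʳ (*-congˡ (exponents k k≤n)))) ⟩
      g * (E ⁻¹ * (Dj * (Qnn * Ck) * (Dk * QNk)))
        ≈⟨ *-congˡ (*-congˡ (solve 5 (λ Dj Qnn Ck Dk Q → Dj :* (Qnn :* Ck) :* (Dk :* Q) := (Dj :* Qnn) :* ((Dk :* Q) :* Ck))
                                   refl Dj Qnn Ck Dk QNk)) ⟩
      g * (E ⁻¹ * ((Dj * Qnn) * ((Dk * QNk) * Ck)))
        ≈⟨ *-congˡ (*-congˡ (*-cong (sym E≈) (*-congʳ (sym [-dqᴺ]ᵏ≈)))) ⟩
      g * (E ⁻¹ * (E * (pow (- (d * pow q N)) k * Ck)))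
        ≈⟨ *-congˡ (⁻¹-cancelˡ _ E≉0) ⟩
      binomialTerm k ∎
      where
      g E C' Cn Ck QNk Qnn Dj Dk : Carrier
      g   = gauss n k
      E   = pow (- γ) (n ∸ k)
      C'  = pow q ((n ℕ.+ 1 ∸ k) C 2)
      Cn  = pow q (n C 2)
      Ck  = pow q (k C 2)
      QNk = pow (pow q N) k
      Qnn = pow (pow q n) (n ∸ k)
      Dj  = pow (- d) (n ∸ k)
      Dk  = pow (- d) k
      E≉0 : Nonzero E
      E≉0 = pow-nonzero (n ∸ k) (-‿nonzero γ≉0)
      -- -γ = (-d) q^n
      E≈ : E ≈ Dj * Qnn
      E≈ = trans (pow-cong (n ∸ k) (trans (-‿cong (sym dqⁿ≈γ)) (-‿distribˡ-* d (pow q n))))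
                 (pow-distrib (- d) (pow q n) (n ∸ k))
      [-dqᴺ]ᵏ≈ : pow (- (d * pow q N)) k ≈ Dk * QNk
      [-dqᴺ]ᵏ≈ = trans (pow-cong k (-‿distribˡ-* d (pow q N))) (pow-distrib (- d) (pow q N) k)

    first-identity : S ⁻¹ * sumTo n (λ k → weight k * (G ⁻¹ * pow (pow q k) N)) ≈ H ⁻¹
    first-identity = begin
      S ⁻¹ * sumTo n (λ k → weight k * (G ⁻¹ * pow (pow q k) N))
        ≈⟨ *-congˡ (trans (sum-cong n summand) (sum-scale n _ _)) ⟩
      S ⁻¹ * ((G ⁻¹ * A ⁻¹) * sumTo n binomialTerm)
        ≈⟨ *-congˡ (*-congˡ (q-binomial n (d * pow q N))) ⟩
      S ⁻¹ * ((G ⁻¹ * A ⁻¹) * M)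
        ≈⟨ sym (⁻¹-unique d-poch≉0 H-inverse) ⟩
      H ⁻¹ ∎
      where
      summand : ∀ k → k ≤ n → weight k * (G ⁻¹ * pow (pow q k) N) ≈ (G ⁻¹ * A ⁻¹) * binomialTerm k
      summand k k≤n = begin
        weight k * (G ⁻¹ * Qk)     ≈⟨ x∙yz≈y∙xz (weight k) (G ⁻¹) Qk ⟩
        G ⁻¹ * (weight k * Qk)     ≈⟨ *-congˡ (divide A≉0 (weight-term k k≤n)) ⟩
        G ⁻¹ * (binomialTerm k * A ⁻¹)  ≈⟨ x∙yz≈xz∙y (G ⁻¹) (binomialTerm k) (A ⁻¹) ⟩
        (G ⁻¹ * A ⁻¹) * binomialTerm k  ∎
        where
        Qk : Carrier
        Qk = pow (pow q k) N
      H-inverse : H * (S ⁻¹ * ((G ⁻¹ * A ⁻¹) * M)) ≈ 1#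
      H-inverse = begin
        H * (S ⁻¹ * ((G ⁻¹ * A ⁻¹) * M))
          ≈⟨ solve 5 (λ H s g a M → H :* (s :* ((g :* a) :* M)) := (H :* M) :* (s :* a :* g)) refl H (S ⁻¹) (G ⁻¹) (A ⁻¹) M ⟩
        (H * M) * (S ⁻¹ * A ⁻¹ * G ⁻¹)
          ≈⟨ *-congʳ (trans HM≈d-poch·G (*-congʳ (sym d-poch-reversed))) ⟩
        ((S * A) * G) * (S ⁻¹ * A ⁻¹ * G ⁻¹)
          ≈⟨ solve 6 (λ S A G s a g → ((S :* A) :* G) :* (s :* a :* g) := (S :* s) :* (A :* a) :* (G :* g)) refl S A G (S ⁻¹) (A ⁻¹) (G ⁻¹) ⟩
        (S * S ⁻¹) * (A * A ⁻¹) * (G * G ⁻¹)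
          ≈⟨ *-cong (*-cong (⁻¹-inverse S S≉0) (⁻¹-inverse A A≉0)) (⁻¹-inverse G γ-poch≉0) ⟩
        1# * 1# * 1#
          ≈⟨ trans (*-identityʳ _) (*-identityʳ _) ⟩
        1# ∎

  -- With z = γ q^N the coefficient of
  -- total degree N reduces to
  --   (γq^n;q)_N⁻¹ = Σ_k [n k] γ^k q^{2 binom(k,2)} (γq^k;q)_{n-k} q^{kN} (γq^k;q)_N⁻¹,
  -- which, after exchanging Pochhammer symbols, is the inverse relation at z.
  module SecondIdentity (q γ : Carrier) (n N : ℕ)
      (qq≉0 : ∀ m → Nonzero (poch q q m))
      (γqᵏ-poch≉0 : ∀ k → k ≤ n → Nonzero (poch (γ * pow q k) q N)) where
    open Gaussian q

    G : ℕ → Carrier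
    G k = poch (γ * pow q k) q N

    z : Carrier
    z = γ * pow q N

    weight : ℕ → Carrier
    weight k = qbin q n k * pow γ k * pow q (2 ℕ.* (k C 2)) * poch (γ * pow q k) q (n ∸ k)

    -- Both sides are (γq^k;q)_{(n-k)+N}.
    poch-exchange : ∀ k → k ≤ n → poch (γ * pow q k) q (n ∸ k) * G n ≈ G k * poch (z * pow q k) q (n ∸ k)
    poch-exchange k k≤n = begin
      P * G n                                          ≈⟨ *-congˡ (poch-cong q N γqⁿ≈) ⟩
      P * poch ((γ * qᵏ) * pow q (n ∸ k)) q N          ≈⟨ poch-swap (γ * qᵏ) q (n ∸ k) N ⟩
      G k * poch ((γ * qᵏ) * pow q N) q (n ∸ k)        ≈⟨ *-congˡ (poch-cong q (n ∸ k) (xy∙z≈xz∙y γ qᵏ (pow q N))) ⟩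
      G k * poch (z * qᵏ) q (n ∸ k)                    ∎
      where
      qᵏ P : Carrier
      qᵏ = pow q k
      P  = poch (γ * qᵏ) q (n ∸ k)
      γqⁿ≈ : γ * pow q n ≈ (γ * qᵏ) * pow q (n ∸ k)
      γqⁿ≈ = trans (*-congˡ (trans (qⁿ-split n k k≤n) (*-comm _ _))) (sym (*-assoc _ _ _))

    weight-term : ∀ k → k ≤ n → weight k * pow (pow q k) N * G k ⁻¹ * G n ≈ gauss n k * inverseTerm n z k
    weight-term k k≤n = begin
      qbin q n k * γᵏ * Cₖ * P * Qk * G k ⁻¹ * G n
        ≈⟨ *-congʳ (*-congʳ (*-congʳ (*-congʳ (*-congʳ (*-congʳ (qbin≈gauss qq≉0 n k k≤n)))))) ⟩
      g * γᵏ * Cₖ * P * Qk * G k ⁻¹ * G n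
        ≈⟨ solve 7 (λ g γk Cₖ P Q i Gn → g :* γk :* Cₖ :* P :* Q :* i :* Gn := g :* (γk :* Q) :* Cₖ :* i :* (P :* Gn))
                   refl g γᵏ Cₖ P Qk (G k ⁻¹) (G n) ⟩
      g * (γᵏ * Qk) * Cₖ * G k ⁻¹ * (P * G n)
        ≈⟨ *-congˡ (poch-exchange k k≤n) ⟩
      g * (γᵏ * Qk) * Cₖ * G k ⁻¹ * (G k * Pz)
        ≈⟨ solve 6 (λ g w Cₖ i Gk Pz → g :* w :* Cₖ :* i :* (Gk :* Pz) := g :* (w :* Cₖ :* Pz) :* (i :* Gk))
                   refl g (γᵏ * Qk) Cₖ (G k ⁻¹) (G k) Pz ⟩
      g * ((γᵏ * Qk) * Cₖ * Pz) * (G k ⁻¹ * G k)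
        ≈⟨ trans (*-congˡ (⁻¹-inverseˡ (γqᵏ-poch≉0 k k≤n))) (*-identityʳ _) ⟩
      g * ((γᵏ * Qk) * Cₖ * Pz)
        ≈⟨ *-congˡ (*-congʳ (*-congʳ (sym zᵏ≈))) ⟩
      gauss n k * inverseTerm n z k ∎
      where
      g γᵏ Cₖ P Pz Qk : Carrier
      g  = gauss n k
      γᵏ = pow γ k
      Cₖ = pow q (2 ℕ.* (k C 2))
      P  = poch (γ * pow q k) q (n ∸ k)
      Pz = poch (z * pow q k) q (n ∸ k)
      Qk = pow (pow q k) N
      zᵏ≈ : pow z k ≈ γᵏ * Qk
      zᵏ≈ = trans (pow-distrib γ (pow q N) k) (*-congˡ (pow-swap q N k))

    second-identity : sumTo n (λ k → weight k * (G k ⁻¹ * pow (pow q k) N)) ≈ G n ⁻¹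
    second-identity = begin
      sumTo n (λ k → weight k * (G k ⁻¹ * pow (pow q k) N))
        ≈⟨ trans (sum-cong n summand) (sum-scale n _ _) ⟩
      G n ⁻¹ * sumTo n (λ k → gauss n k * inverseTerm n z k)
        ≈⟨ *-congˡ (inverse-sum n z) ⟩
      G n ⁻¹ * 1#
        ≈⟨ *-identityʳ _ ⟩
      G n ⁻¹ ∎
      where
      summand : ∀ k → k ≤ n → weight k * (G k ⁻¹ * pow (pow q k) N) ≈ G n ⁻¹ * (gauss n k * inverseTerm n z k)
      summand k k≤n = begin
        weight k * (G k ⁻¹ * Qk)    ≈⟨ x∙yz≈xz∙y (weight k) (G k ⁻¹) Qk ⟩
        weight k * Qk * G k ⁻¹      ≈⟨ divide (γqᵏ-poch≉0 n ℕP.≤-refl) (weight-term k k≤n) ⟩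
        (gauss n k * inverseTerm n z k) * G n ⁻¹  ≈⟨ *-comm _ _ ⟩
        G n ⁻¹ * (gauss n k * inverseTerm n z k)  ∎
        where
        Qk : Carrier
        Qk = pow (pow q k) N

  appellWeight : (q a a' b b' : Carrier) → ℕ → ℕ → Carrier
  appellWeight q a a' b b' m l =
    (poch a q m * poch a' q l * poch b q m * poch b' q l) * (poch q q m * poch q q l) ⁻¹

  -- At (ux, uy) the (m,l) coefficient of Φ3 depends on γ and u only through
  -- (γ;q)_{m+l}⁻¹ u^{m+l}; this reduces both identities to scalar ones.
  Φ3-coefficient : ∀ q a a' b b' γ u m l → Nonzero (poch q q m * poch q q l) → Nonzero (poch γ q (m ℕ.+ l)) →
    Φ3 q a a' b b' γ u u m l ≈ appellWeight q a a' b b' m l * (poch γ q (m ℕ.+ l) ⁻¹ * pow u (m ℕ.+ l))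
  Φ3-coefficient q a a' b b' γ u m l qq≉0 γ-poch≉0 = begin
    (Nm * (Q * Γ) ⁻¹) * (pow u m * pow u l)  ≈⟨ *-cong (*-congˡ (⁻¹-distrib-* qq≉0 γ-poch≉0)) (sym (pow-+ u m l)) ⟩
    (Nm * (Q ⁻¹ * Γ ⁻¹)) * pow u (m ℕ.+ l)   ≈⟨ solve 4 (λ N p g U → (N :* (p :* g)) :* U := (N :* p) :* (g :* U)) refl Nm (Q ⁻¹) (Γ ⁻¹) (pow u (m ℕ.+ l)) ⟩
    (Nm * Q ⁻¹) * (Γ ⁻¹ * pow u (m ℕ.+ l))   ∎
    where
    Nm Q Γ : Carrier
    Nm = poch a q m * poch a' q l * poch b q m * poch b' q l
    Q  = poch q q m * poch q q l
    Γ  = poch γ q (m ℕ.+ l)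

  Φ3-coefficient-at-one : ∀ q a a' b b' γ m l → Nonzero (poch q q m * poch q q l) → Nonzero (poch γ q (m ℕ.+ l)) →
    Φ3 q a a' b b' γ 1# 1# m l ≈ appellWeight q a a' b b' m l * poch γ q (m ℕ.+ l) ⁻¹
  Φ3-coefficient-at-one q a a' b b' γ m l qq≉0 γ-poch≉0 =
    trans (Φ3-coefficient q a a' b b' γ 1# m l qq≉0 γ-poch≉0)
          (*-congˡ (trans (*-congˡ (pow-one (m ℕ.+ l))) (*-identityʳ _)))

  first-series-identity : ∀ q a a' b b' γ n →
    Nonzero q → Nonzero γ → (∀ m → Nonzero (poch q q m)) → (∀ N → Nonzero (poch γ q N)) →
    (∀ N → Nonzero (poch (γ * pow (q ⁻¹) n) q N)) → Nonzero (poch (q * (γ ⁻¹)) q n) →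
    Φ3 q a a' b b' (γ * pow (q ⁻¹) n) 1# 1#
      ≋ ((poch (q * (γ ⁻¹)) q n ⁻¹) ·ₛ
          sumSeries n (λ k →
            (qbin q n k * (pow (- γ) (n ∸ k) ⁻¹) * pow q ((n ℕ.+ 1 ∸ k) C 2))
              ·ₛ Φ3 q a a' b b' γ (pow q k) (pow q k)))
  first-series-identity q a a' b b' γ n q≉0 γ≉0 qq≉0 γ-poch≉0 d-poch≉0 S≉0 m l = begin
    Φ3 q a a' b b' d 1# 1# m l
      ≈⟨ Φ3-coefficient-at-one q a a' b b' d m l qqml≉0 (d-poch≉0 N) ⟩
    K * H ⁻¹
      ≈⟨ *-congˡ (sym first-identity) ⟩
    K * (S ⁻¹ * sumTo n (λ k → weight k * (G ⁻¹ * pow (pow q k) N)))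
      ≈⟨ x∙yz≈y∙xz K (S ⁻¹) _ ⟩
    S ⁻¹ * (K * sumTo n (λ k → weight k * (G ⁻¹ * pow (pow q k) N)))
      ≈⟨ *-congˡ (sym (sum-factor n K weight _)) ⟩
    S ⁻¹ * sumTo n (λ k → weight k * (K * (G ⁻¹ * pow (pow q k) N)))
      ≈⟨ *-congˡ (sum-cong n (λ k _ → *-congˡ (sym (Φ3-coefficient q a a' b b' γ (pow q k) m l qqml≉0 (γ-poch≉0 N))))) ⟩
    S ⁻¹ * sumTo n (λ k → weight k * Φ3 q a a' b b' γ (pow q k) (pow q k) m l) ∎
    where
    N : ℕ
    N = m ℕ.+ l
    K : Carrier
    K = appellWeight q a a' b b' m l
    qqml≉0 : Nonzero (poch q q m * poch q q l)
    qqml≉0 = *-nonzero (qq≉0 m) (qq≉0 l)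
    open FirstIdentity q γ n N q≉0 γ≉0 qq≉0 (γ-poch≉0 N) (d-poch≉0 N) S≉0

  second-series-identity : ∀ q a a' b b' γ n →
    (∀ m → Nonzero (poch q q m)) → (∀ k N → k ≤ n → Nonzero (poch (γ * pow q k) q N)) →
    Φ3 q a a' b b' (γ * pow q n) 1# 1#
      ≋ sumSeries n (λ k →
          (qbin q n k * pow γ k * pow q (2 ℕ.* (k C 2)) * poch (γ * pow q k) q (n ∸ k))
            ·ₛ Φ3 q a a' b b' (γ * pow q k) (pow q k) (pow q k))
  second-series-identity q a a' b b' γ n qq≉0 γqᵏ-poch≉0 m l = begin
    Φ3 q a a' b b' (γ * pow q n) 1# 1# m l
      ≈⟨ Φ3-coefficient-at-one q a a' b b' (γ * pow q n) m l qqml≉0 (γqᵏ-poch≉0 n N ℕP.≤-refl) ⟩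
    K * G n ⁻¹
      ≈⟨ *-congˡ (sym second-identity) ⟩
    K * sumTo n (λ k → weight k * (G k ⁻¹ * pow (pow q k) N))
      ≈⟨ sym (sum-factor n K weight _) ⟩
    sumTo n (λ k → weight k * (K * (G k ⁻¹ * pow (pow q k) N)))
      ≈⟨ sum-cong n (λ k k≤n → *-congˡ (sym (Φ3-coefficient q a a' b b' (γ * pow q k) (pow q k) m l qqml≉0 (γqᵏ-poch≉0 k N k≤n)))) ⟩
    sumTo n (λ k → weight k * Φ3 q a a' b b' (γ * pow q k) (pow q k) (pow q k) m l) ∎
    where
    N : ℕ
    N = m ℕ.+ l
    K : Carrier
    K = appellWeight q a a' b b' m l
    qqml≉0 : Nonzero (poch q q m * poch q q l)
    qqml≉0 = *-nonzero (qq≉0 m) (qq≉0 l)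
    open SecondIdentity q γ n N qq≉0 (λ k → γqᵏ-poch≉0 k N)

theorem13 : ∀ {c ℓ : Level} (F : Field c ℓ) →
    let open Field F
        open QDefs F
    in (q a a' b b' γ : Carrier) (n : ℕ) → 1 ≤ n →
       ¬ (q ≈ 0#) → ¬ (γ ≈ 0#) →
       (∀ m → ¬ (poch q q m ≈ 0#)) →
       (∀ N → ¬ (poch γ q N ≈ 0#)) →
       (∀ N → ¬ (poch (γ * pow (q ⁻¹) n) q N ≈ 0#)) →
       (∀ N → ¬ (poch (γ * pow q n) q N ≈ 0#)) →
       (∀ k N → k ≤ n → ¬ (poch (γ * pow q k) q N ≈ 0#)) →
       ¬ (poch (q * (γ ⁻¹)) q n ≈ 0#) →
       (Φ3 q a a' b b' (γ * pow (q ⁻¹) n) 1# 1#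
          ≋ ((poch (q * (γ ⁻¹)) q n ⁻¹) ·ₛ
              sumSeries n (λ k →
                (qbin q n k * (pow (- γ) (n ∸ k) ⁻¹) * pow q ((n ℕ.+ 1 ∸ k) C 2))
                  ·ₛ Φ3 q a a' b b' γ (pow q k) (pow q k))))
       ×
       (Φ3 q a a' b b' (γ * pow q n) 1# 1#
          ≋ sumSeries n (λ k →
              (qbin q n k * pow γ k * pow q (2 ℕ.* (k C 2)) * poch (γ * pow q k) q (n ∸ k))
                ·ₛ Φ3 q a a' b b' (γ * pow q k) (pow q k) (pow q k)))
-- The identities hold for every n, and nonvanishing of
-- (cq^n;q)_N is already the case k = n of the hypothesis on (cq^k;q)_N.
theorem13 F q a a' b b' γ n _ q≉0 γ≉0 qq≉0 γ-poch≉0 d-poch≉0 _ γqᵏ-poch≉0 S≉0 =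
    first-series-identity q a a' b b' γ n q≉0 γ≉0 qq≉0 γ-poch≉0 d-poch≉0 S≉0
  , second-series-identity q a a' b b' γ n qq≉0 γqᵏ-poch≉0
  where open QCalculus F
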